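{- There is an algorithm that, given graphs $G$ and $H$ with $n=|V(G)|+|V(H)|$, creates in time $\operatorname{poly}(n)\cdot 2^n$ a list of $2^n$ instances $(G_i,H_i)$ of Subgraph Isomorphism, in each of which the graphs $G_i$ and $H_i$ have $n$ vertices, such that there is a homomorphism from $G$ to $H$ if and only if for at least one of the created instances $(G_i,H_i)$ the graph $G_i$ is a subgraph of $H_i$.
   Context: All graphs are finite, simple (no loops, no multiple edges) and undirected. A homomorphism from $G$ to $H$ is a map $g:V(G)\to V(H)$ such that $g(u)g(v)\in E(H)$ for every edge $uv\in E(G)$. An instance of Subgraph Isomorphism is a pair of graphs $(G,H)$; it is a yes-instance if $G$ is a subgraph of $H$, i.e., there exists an injective map $g:V(G)\to V(H)$ such that $g(u)g(v)\in E(H)$ for every $uv\in E(G)$. The instances in the list need not be pairwise distinct.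
   Formalization: The case where G has one vertex and H has no vertices is excluded: there is then no homomorphism from G to H, but n = 1 and every instance with one vertex on each side is a yes-instance, so the claim fails there. -}

module Defs where

open import Data.Bool.Base using (Bool; true; false; T)
open import Data.Fin.Base using (Fin; zero)
open import Data.List.Base as List using (List; []; _∷_; _++_)
open import Data.Maybe.Base using (Maybe)
open import Data.Nat.Base using (ℕ; suc; _+_)
open import Data.Product.Base using (Σ-syntax; ∃-syntax; _×_; _,_)
open import Data.Vec.Base as Vec using (Vec; lookup; _[_]%=_)
open import Function.Base using (id)
open import Function.Definitions using (Injective)
open import Relation.Binary.PropositionalEquality.Core using (_≡_)
open import Relation.Nullary.Negation.Core using (¬_)

record Graph (n : ℕ) : Set where
  field
    adj    : Fin n → Fin n → Bool
    symm   : ∀ u v → adj u v ≡ adj v u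
    irrefl : ∀ u → adj u u ≡ false

  Edge : Fin n → Fin n → Set
  Edge u v = T (adj u v)

open Graph public

private variable
  g h k n : ℕ

IsHomomorphism : Graph g → Graph h → (Fin g → Fin h) → Set
IsHomomorphism G H f = ∀ u v → Edge G u v → Edge H (f u) (f v)

Homomorphism : Graph g → Graph h → Set
Homomorphism {g} {h} G H = Σ[ f ∈ (Fin g → Fin h) ] IsHomomorphism G H f

infix 4 _⊆_
_⊆_ : Graph g → Graph h → Set
_⊆_ {g} {h} G H =
  Σ[ f ∈ (Fin g → Fin h) ] Injective _≡_ _≡_ f × IsHomomorphism G H f

Instance : ℕ → Set
Instance n = Graph n × Graph n

YesInstance : Instance n → Set
YesInstance (G , H) = G ⊆ H

-- If the null graph is admitted, then one case has to be set apart: there is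
-- no homomorphism from the one-vertex graph to the null graph, but n = 1 and
-- all instances with one vertex on each side are yes-instances.
null-target : (G : Graph 1) (H : Graph 0) → ¬ Homomorphism G H
null-target G H (f , _) with f zero
... | ()

one-vertex-yes : (I : Instance 1) → YesInstance I
one-vertex-yes (G , H) = id , id , edge
  where
  edge : IsHomomorphism G H id
  edge zero zero e with adj G zero zero | irrefl G zero
  edge zero zero () | false | _

-- Programs with structured control flow over k stacks of bits.  A
-- primitive step inspects or changes the top of a single stack.  A stack is
-- a tape with its head at one end, and a tape is a pair of stacks, so up to
-- constant factors (depending on the program only) the running time is that
-- of a multitape Turing machine.

Test : Set
Test = Maybe Bool → Bool

data Program (k : ℕ) : Set where
  skip  : Program k
  push  : Fin k → Bool → Program k
  pop   : Fin k → Program k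
  _⨾_   : Program k → Program k → Program k
  if    : Fin k → Test → Program k → Program k → Program k
  while : Fin k → Test → Program k → Program k

infixr 5 _⨾_

Store : ℕ → Set
Store k = Vec (List Bool) k

-- The test sees `nothing` when the stack is empty.
check : Fin k → Test → Store k → Bool
check x φ σ = φ (List.head (lookup σ x))

-- ⟨ P , σ ⟩⇓[ t ] τ : started on σ, P halts after exactly t steps on τ.
data ⟨_,_⟩⇓[_]_ {k : ℕ} : Program k → Store k → ℕ → Store k → Set where
  skip : ∀ {σ} →
    ⟨ skip , σ ⟩⇓[ 1 ] σ
  push : ∀ {σ x b} →
    ⟨ push x b , σ ⟩⇓[ 1 ] (σ [ x ]%= (b ∷_))
  pop : ∀ {σ x} →
    ⟨ pop x , σ ⟩⇓[ 1 ] (σ [ x ]%= List.drop 1)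
  seq : ∀ {P Q ρ σ τ s t} →
    ⟨ P , ρ ⟩⇓[ s ] σ → ⟨ Q , σ ⟩⇓[ t ] τ →
    ⟨ P ⨾ Q , ρ ⟩⇓[ s + t ] τ
  if-true : ∀ {x φ P Q σ τ t} → check x φ σ ≡ true →
    ⟨ P , σ ⟩⇓[ t ] τ →
    ⟨ if x φ P Q , σ ⟩⇓[ suc t ] τ
  if-false : ∀ {x φ P Q σ τ t} → check x φ σ ≡ false →
    ⟨ Q , σ ⟩⇓[ t ] τ →
    ⟨ if x φ P Q , σ ⟩⇓[ suc t ] τ
  while-true : ∀ {x φ P ρ σ τ s t} → check x φ ρ ≡ true →
    ⟨ P , ρ ⟩⇓[ s ] σ → ⟨ while x φ P , σ ⟩⇓[ t ] τ →
    ⟨ while x φ P , ρ ⟩⇓[ suc (s + t) ] τ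
  while-false : ∀ {x φ P σ} → check x φ σ ≡ false →
    ⟨ while x φ P , σ ⟩⇓[ 1 ] σ

-- Input and output are the entire contents of stack 0, top of stack first;
-- all other stacks are initially empty and finally arbitrary.
_on_outputs_in-time_ : Program (suc k) → List Bool → List Bool → ℕ → Set
_on_outputs_in-time_ {k} P input output t =
  ∃[ τ ] ⟨ P , input Vec.∷ Vec.replicate k [] ⟩⇓[ t ] τ × Vec.head τ ≡ output

-- All encodings are self-delimiting bit strings.

-- The number of vertices in unary, then the adjacency matrix row by row.
encodeGraph : Graph n → List Bool
encodeGraph {n} G =
  List.replicate n true ++ false ∷
  List.concat (List.tabulate λ u → List.tabulate (adj G u))

encodePair : Graph g → Graph h → List Bool
encodePair G H = encodeGraph G ++ encodeGraph H

-- Each instance is preceded by the bit 1; the bit 0 ends the list.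
encodeInstances : List (Instance n) → List Bool
encodeInstances []             = false ∷ []
encodeInstances ((G , H) ∷ Is) = true ∷ encodePair G H ++ encodeInstances Is

-- Read w ∈ {0,1}ⁿ as stars (0) and bars (1).  The stars before the first bar
-- form block 0, those between the first and the second bar block 1, and so
-- on.  H_w is the blow-up of H in which vertex i is replaced by the
-- independent set of the stars in block i, all other positions being isolated.
-- A homomorphism G → H is an embedding of G, padded with h isolated vertices,
-- in the H_w whose blocks have the sizes of its fibres: g stars and h bars are
-- n symbols.  Conversely, an embedding in any H_w followed by the block number
-- is a homomorphism.  A binary counter runs through the 2ⁿ words w.  The
-- matrix of H_w arises from that of H when a bar advances to the next row or
-- column and a star reads the current one.  Apart from the counter loop, every
-- loop makes at most (n + 1)² + 2 rounds, so that the time is polynomial by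
-- induction on the program.
module Submission where

open import Defs
open import Data.Bool.Base using (Bool; true; false; T; not; _xor_)
open import Data.Bool.Properties using (xor-comm; xor-same)
open import Data.Empty using (⊥-elim)
open import Data.Fin.Base using (Fin; zero; suc; punchIn; _↑ˡ_)
open import Data.Fin.Patterns
import Data.Fin.Properties as Fin
open import Data.List.Base as List
  using (List; []; _∷_; _++_; _ʳ++_; length; replicate; concat; tabulate; take; drop)
open import Data.List.Properties
  using ( ++-assoc; ++-identityʳ; ++-ʳ++; ʳ++-ʳ++; concat-++; drop-[]; length-++; length-replicate
        ; length-reverse; length-tabulate; length-take; length-ʳ++; map-tabulate
        ; reverse-involutive; tabulate-cong; take-[]; take++drop≡id)
open import Data.List.Relation.Unary.All using (All; []; _∷_)
open import Data.List.Relation.Unary.All.Properties using (drop⁺; tabulate⁺)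
open import Data.Maybe.Base as Maybe using (Maybe; just; nothing)
open import Data.Maybe.Properties using (maybe′-map)
open import Data.Nat.Base using (ℕ; zero; suc; _+_; _*_; _^_; _≤_; z≤n; s≤s; >-nonZero)
open import Data.Nat.Properties
open import Data.Nat.Tactic.RingSolver using (solve-∀)
open import Data.Product.Base using (∃-syntax; Σ-syntax; _×_; _,_)
open import Data.Vec.Base as Vec using (Vec; []; _∷_; toList; lookup; _[_]%=_; _[_]≔_)
open import Data.Vec.Membership.Propositional using (_∈_)
open import Data.Vec.Membership.Propositional.Properties using (∈-lookup; ∈-++⁺ˡ; ∈-++⁺ʳ)
import Data.Vec.Properties as Vec
import Data.Vec.Relation.Unary.All as VAll
import Data.Vec.Relation.Unary.All.Properties as VAll
open import Data.Vec.Relation.Unary.AllPairs using (allPairs?)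
open import Data.Vec.Relation.Unary.Any as Any using (Any; here)
import Data.Vec.Relation.Unary.Any.Properties as Any
open import Data.Vec.Relation.Unary.Unique.Propositional using (Unique; []; _∷_)
open import Function.Base using (_∘_; const)
open import Function.Bundles using (_⇔_; mk⇔)
open import Function.Definitions using (Injective)
open import Relation.Binary.PropositionalEquality
  using (_≡_; refl; sym; trans; cong; cong₂; subst; subst₂; module ≡-Reasoning)
open import Relation.Nullary.Decidable using (True; toWitness; ¬?)
open import Relation.Nullary.Negation.Core using (¬_)

private variable
  g h i j k m n : ℕ
  A : Set
  b : Bool
  xs ys zs cs ts : List Bool
  x : Fin k
  φ : Test
  P Q : Program k
  ρ σ τ : Store k

-- Subprograms on selected stacks

get : Vec (Fin k) j → Vec A k → Vec A j
get ρ σ = Vec.map (lookup σ) ρ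

put : Vec (Fin k) j → Vec A j → Vec A k → Vec A k
put []      []      σ = σ
put (x ∷ ρ) (a ∷ α) σ = put ρ α σ [ x ]≔ a

lookup-put : ∀ {ρ : Vec (Fin k) j} → Unique ρ → ∀ (α : Vec A j) σ i →
             lookup (put ρ α σ) (lookup ρ i) ≡ lookup α i
lookup-put {ρ = x ∷ ρ} _ (a ∷ α) σ zero = Vec.lookup∘update x (put ρ α σ) a
lookup-put {ρ = x ∷ ρ} (x∉ρ ∷ u) (a ∷ α) σ (suc i) =
  trans (Vec.lookup∘update′ (VAll.lookup x∉ρ (∈-lookup i ρ) ∘ sym) (put ρ α σ) a)
        (lookup-put u α σ i)

put-update : ∀ {ρ : Vec (Fin k) j} → Unique ρ → ∀ (α : Vec A j) σ i f →
             put ρ (α [ i ]%= f) σ ≡ put ρ α σ [ lookup ρ i ]%= f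
put-update {ρ = x ∷ ρ} _ (a ∷ α) σ zero f =
  sym (Vec.updateAt-updateAt x (put ρ α σ))
put-update {ρ = x ∷ ρ} (x∉ρ ∷ u) (a ∷ α) σ (suc i) f =
  trans (cong (_[ x ]≔ a) (put-update u α σ i f))
        (Vec.updateAt-commutes x _ (VAll.lookup x∉ρ (∈-lookup i ρ)) (put ρ α σ))

put-get : ∀ (ρ : Vec (Fin k) j) (σ : Vec A k) → put ρ (get ρ σ) σ ≡ σ
put-get []      σ = refl
put-get (x ∷ ρ) σ =
  trans (cong (_[ x ]≔ lookup σ x) (put-get ρ σ)) (Vec.[]≔-lookup σ x)

use : Vec (Fin k) j → Program j → Program k
use ρ skip          = skip
use ρ (push x b)    = push (lookup ρ x) b
use ρ (pop x)       = pop (lookup ρ x)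
use ρ (P ⨾ Q)       = use ρ P ⨾ use ρ Q
use ρ (if x φ P Q)  = if (lookup ρ x) φ (use ρ P) (use ρ Q)
use ρ (while x φ P) = while (lookup ρ x) φ (use ρ P)

check-put : ∀ {ρ : Vec (Fin k) j} → Unique ρ → ∀ α σ x φ {b} →
            check x φ α ≡ b → check (lookup ρ x) φ (put ρ α σ) ≡ b
check-put u α σ x φ = trans (cong (φ ∘ List.head) (lookup-put u α σ x))

-- Distinctness makes this a step-by-step simulation: a change of one selected stack is invisible on
-- the others, so tests agree and no step is added.
use-⇓ : ∀ {ρ : Vec (Fin k) j} → Unique ρ → ∀ σ {P α β t} →
        ⟨ P , α ⟩⇓[ t ] β → ⟨ use ρ P , put ρ α σ ⟩⇓[ t ] put ρ β σ
use-⇓ u σ skip = skip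
use-⇓ u σ (push {α} {x} {b}) rewrite put-update u α σ x (b ∷_) = push
use-⇓ u σ (pop {α} {x}) rewrite put-update u α σ x (List.drop 1) = pop
use-⇓ u σ (seq p q) = seq (use-⇓ u σ p) (use-⇓ u σ q)
use-⇓ u σ (if-true {x} {φ} {σ = α} c p) = if-true (check-put u α σ x φ c) (use-⇓ u σ p)
use-⇓ u σ (if-false {x} {φ} {σ = α} c p) = if-false (check-put u α σ x φ c) (use-⇓ u σ p)
use-⇓ u σ (while-true {x} {φ} {ρ = α} c p q) =
  while-true (check-put u α σ x φ c) (use-⇓ u σ p) (use-⇓ u σ q)
use-⇓ u σ (while-false {x} {φ} {σ = α} c) = while-false (check-put u α σ x φ c)

-- Time bounds

-- An upper bound for the running time when no loop makes more than m rounds.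
cost : ℕ → Program k → ℕ
cost m skip          = 1
cost m (push x b)    = 1
cost m (pop x)       = 1
cost m (P ⨾ Q)       = cost m P + cost m Q
cost m (if x φ P Q)  = suc (cost m P + cost m Q)
cost m (while x φ P) = suc (m * suc (cost m P))

cost-use : ∀ m (ρ : Vec (Fin k) j) P → cost m (use ρ P) ≡ cost m P
cost-use m ρ skip          = refl
cost-use m ρ (push x b)    = refl
cost-use m ρ (pop x)       = refl
cost-use m ρ (P ⨾ Q)       = cong₂ _+_ (cost-use m ρ P) (cost-use m ρ Q)
cost-use m ρ (if x φ P Q)  = cong suc (cong₂ _+_ (cost-use m ρ P) (cost-use m ρ Q))
cost-use m ρ (while x φ P) = cong (λ a → suc (m * suc a)) (cost-use m ρ P)

-- Coefficient and exponent of a polynomial bound for `cost`. Exponents are added where a maximum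
-- would do, which is crude but sufficient.
size degree : Program k → ℕ
size skip          = 1
size (push x b)    = 1
size (pop x)       = 1
size (P ⨾ Q)       = size P + size Q
size (if x φ P Q)  = suc (size P + size Q)
size (while x φ P) = suc (size P)

degree skip          = 0
degree (push x b)    = 0
degree (pop x)       = 0
degree (P ⨾ Q)       = degree P + degree Q
degree (if x φ P Q)  = degree P + degree Q
degree (while x φ P) = suc (degree P)

*-^-+ : ∀ m s s′ d d′ →
        s * suc m ^ d + s′ * suc m ^ d′ ≤ (s + s′) * suc m ^ (d + d′)
*-^-+ m s s′ d d′ = begin
  s * M ^ d + s′ * M ^ d′
    ≤⟨ +-mono-≤ (*-monoʳ-≤ s (^-monoʳ-≤ M (m≤m+n d d′)))
                (*-monoʳ-≤ s′ (^-monoʳ-≤ M (m≤n+m d′ d))) ⟩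
  s * M ^ (d + d′) + s′ * M ^ (d + d′)
    ≡⟨ *-distribʳ-+ (M ^ (d + d′)) s s′ ⟨
  (s + s′) * M ^ (d + d′) ∎
  where
  open ≤-Reasoning
  M = suc m

suc-*-^ : ∀ m s d {a} → a ≤ s * suc m ^ d → suc a ≤ suc s * suc m ^ d
suc-*-^ m s d = +-mono-≤ (m^n>0 (suc m) d)

-- A loop multiplies the cost by about `suc m` and so raises the exponent by one. The base is
-- `suc m` because its powers are at least 1 and absorb the single steps.
cost-polynomial : ∀ m (P : Program k) → cost m P ≤ size P * suc m ^ degree P
cost-polynomial m skip       = ≤-refl
cost-polynomial m (push x b) = ≤-refl
cost-polynomial m (pop x)    = ≤-refl
cost-polynomial m (P ⨾ Q) =
  ≤-trans (+-mono-≤ (cost-polynomial m P) (cost-polynomial m Q))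
          (*-^-+ m (size P) (size Q) (degree P) (degree Q))
cost-polynomial m (if x φ P Q) =
  suc-*-^ m (size P + size Q) (degree P + degree Q)
    (≤-trans (+-mono-≤ (cost-polynomial m P) (cost-polynomial m Q))
             (*-^-+ m (size P) (size Q) (degree P) (degree Q)))
cost-polynomial m (while x φ P) = begin
  suc (m * suc a)                       ≤⟨ s≤s (m≤n+m (m * suc a) a) ⟩
  suc m * suc a                         ≤⟨ *-monoʳ-≤ (suc m) (suc-*-^ m s d (cost-polynomial m P)) ⟩
  suc m * (suc s * suc m ^ d)           ≡⟨ *-assoc (suc m) (suc s) (suc m ^ d) ⟨
  suc m * suc s * suc m ^ d             ≡⟨ cong (_* suc m ^ d) (*-comm (suc m) (suc s)) ⟩
  suc s * suc m * suc m ^ d             ≡⟨ *-assoc (suc s) (suc m) (suc m ^ d) ⟩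
  suc s * suc m ^ suc d                 ∎
  where
  open ≤-Reasoning
  a = cost m P
  s = size P
  d = degree P

-- Runs within the time bounds.

record Run (m : ℕ) (P : Program k) (ρ σ : Store k) : Set where
  constructor run
  field
    {time}  : ℕ
    time≤   : time ≤ cost m P
    halts   : ⟨ P , ρ ⟩⇓[ time ] σ

-- The bound counts the actual rounds `i` instead of `m`: an induction can add one round at a time,
-- and the counter loop, whose rounds may exceed `m`, is covered as well.
record Loop (m : ℕ) (x : Fin k) (φ : Test) (P : Program k) (i : ℕ) (ρ σ : Store k) : Set where
  constructor loop
  field
    {time}  : ℕ
    time≤   : time ≤ suc (i * suc (cost m P))
    halts   : ⟨ while x φ P , ρ ⟩⇓[ time ] σ

skipped : Run m skip σ σ
skipped = run ≤-refl skip

pushed : ∀ {x : Fin k} {b} → Run m (push x b) σ (σ [ x ]%= (b ∷_))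
pushed = run ≤-refl push

popped : ∀ {x : Fin k} → Run m (pop x) σ (σ [ x ]%= List.drop 1)
popped = run ≤-refl pop

infixr 5 _►_
_►_ : Run m P ρ σ → Run m Q σ τ → Run m (P ⨾ Q) ρ τ
run a p ► run b q = run (+-mono-≤ a b) (seq p q)

then-branch : check x φ σ ≡ true → Run m P σ τ → Run m (if x φ P Q) σ τ
then-branch c (run a p) = run (s≤s (≤-trans a (m≤m+n _ _))) (if-true c p)

else-branch : check x φ σ ≡ false → Run m Q σ τ → Run m (if x φ P Q) σ τ
else-branch c (run a p) = run (s≤s (≤-trans a (m≤n+m _ _))) (if-false c p)

exit : check x φ σ ≡ false → Loop m x φ P 0 σ σ
exit c = loop ≤-refl (while-false c)

infixr 4 _again_then_
_again_then_ : check x φ ρ ≡ true → Run m P ρ σ → Loop m x φ P i σ τ →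
               Loop m x φ P (suc i) ρ τ
_again_then_ {m = m} {P = P} {i = i} c (run a p) (loop b q) =
  loop (s≤s (begin
    _                                       ≤⟨ +-mono-≤ a b ⟩
    cost m P + suc (i * suc (cost m P))     ≡⟨ +-suc (cost m P) _ ⟩
    suc (cost m P + i * suc (cost m P))     ∎))
    (while-true c p q)
  where open ≤-Reasoning

rounds : i ≤ m → Loop m x φ P i ρ σ → Run m (while x φ P) ρ σ
rounds {P = P} i≤m (loop a p) =
  run (≤-trans a (s≤s (*-monoˡ-≤ (suc (cost _ P)) i≤m))) p

-- For a concrete selection of stacks distinctness is decided by evaluation, so that `u` is
-- inferred.
on : (ρ : Vec (Fin k) j) {u : True (allPairs? (λ x y → ¬? (x Fin.≟ y)) ρ)} →
     ∀ {P σ α} → Run m P (get ρ σ) α → Run m (use ρ P) σ (put ρ α σ)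
on {m = m} ρ {u} {P} {σ} {α} (run a p) =
  run (≤-trans a (≤-reflexive (sym (cost-use m ρ P))))
      (subst (λ τ → ⟨ use ρ P , τ ⟩⇓[ _ ] put ρ α σ) (put-get ρ σ)
             (use-⇓ (toWitness u) σ p))

-- On concrete stores most stacks agree by computation; this rewrites the one stack whose content
-- agrees only by a proof.
adjust : ∀ (x : Fin k) {t} → Run m P ρ σ → lookup σ x ≡ t → Run m P ρ (σ [ x ]≔ t)
adjust {m = m} {P = P} {ρ = ρ} {σ = σ} x r refl =
  subst (Run m P ρ) (sym (Vec.[]≔-lookup σ x)) r

adjustᴸ : ∀ {y : Fin k} (x : Fin k) {t} → Loop m y φ P i ρ σ → lookup σ x ≡ t →
          Loop m y φ P i ρ (σ [ x ]≔ t)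
adjustᴸ {m = m} {φ = φ} {P = P} {i = i} {ρ = ρ} {σ = σ} x l refl =
  subst (Loop m _ φ P i ρ) (sym (Vec.[]≔-lookup σ x)) l

isTrue isFalse nonempty : Test
isTrue   = Maybe.fromMaybe false
isFalse  = Maybe.maybe′ not false
nonempty = Maybe.is-just

-- Copying between stacks

-- The superscript ᵖ marks programs on stacks of their own; the same name without
-- it takes the stacks to be used as arguments.
transferᵖ : Program 2
transferᵖ = if 0F isTrue (pop 0F ⨾ push 1F true)
           (if 0F isFalse (pop 0F ⨾ push 1F false) skip)

transfer : Fin k → Fin k → Program k
transfer x y = use (x ∷ y ∷ []) transferᵖ

transfer-∷ : Run m transferᵖ ((b ∷ xs) ∷ ys ∷ []) (xs ∷ (b ∷ ys) ∷ [])
transfer-∷ {b = true}  = then-branch refl (popped ► pushed)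
transfer-∷ {b = false} = else-branch refl (then-branch refl (popped ► pushed))

transfer-[] : Run m transferᵖ ([] ∷ ys ∷ []) ([] ∷ ys ∷ [])
transfer-[] = else-branch refl (else-branch refl skipped)

moveᵖ : Program 2
moveᵖ = while 0F nonempty (transfer 0F 1F)

move : Fin k → Fin k → Program k
move x y = use (x ∷ y ∷ []) moveᵖ

move-ʳ++ : length xs ≤ m → Run m moveᵖ (xs ∷ ys ∷ []) ([] ∷ (xs ʳ++ ys) ∷ [])
move-ʳ++ {xs = xs} len = rounds len (go xs)
  where
  go : ∀ xs {ys} → Loop _ 0F nonempty (transfer 0F 1F) (length xs)
                   (xs ∷ ys ∷ []) ([] ∷ (xs ʳ++ ys) ∷ [])
  go []       = exit refl
  go (x ∷ xs) = refl again on (0F ∷ 1F ∷ []) transfer-∷ then go xs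

restore : length xs ≤ m → Run m moveᵖ ((xs ʳ++ []) ∷ ys ∷ []) ([] ∷ (xs ++ ys) ∷ [])
restore {xs = xs} {m = m} len =
  adjust 1F (move-ʳ++ (subst (_≤ m) (sym (length-reverse xs)) len)) (ʳ++-ʳ++ xs)

restore-all : length xs ≤ m → Run m moveᵖ ((xs ʳ++ []) ∷ [] ∷ []) ([] ∷ xs ∷ [])
restore-all {xs = xs} len =
  adjust 1F (restore len) (++-identityʳ xs)

fork-bodyᵖ : Program 3
fork-bodyᵖ = if 0F isTrue (pop 0F ⨾ push 1F true ⨾ push 2F true)
                          (pop 0F ⨾ push 1F false ⨾ push 2F false)

forkᵖ : Program 3
forkᵖ = while 0F nonempty fork-bodyᵖ

fork : Fin k → Fin k → Fin k → Program k
fork x y z = use (x ∷ y ∷ z ∷ []) forkᵖ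

fork-ʳ++ : length xs ≤ m →
           Run m forkᵖ (xs ∷ ys ∷ zs ∷ []) ([] ∷ (xs ʳ++ ys) ∷ (xs ʳ++ zs) ∷ [])
fork-ʳ++ {xs = xs} len = rounds len (go xs)
  where
  go : ∀ xs {ys zs} → Loop _ 0F nonempty fork-bodyᵖ (length xs)
       (xs ∷ ys ∷ zs ∷ []) ([] ∷ (xs ʳ++ ys) ∷ (xs ʳ++ zs) ∷ [])
  go []           = exit refl
  go (true  ∷ xs) = refl again then-branch refl (popped ► pushed ► pushed) then go xs
  go (false ∷ xs) = refl again else-branch refl (popped ► pushed ► pushed) then go xs

fork-restore : length xs ≤ m →
  Run m forkᵖ ((xs ʳ++ []) ∷ ys ∷ zs ∷ []) ([] ∷ (xs ++ ys) ∷ (xs ++ zs) ∷ [])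
fork-restore {xs = xs} {m = m} len =
  adjust 2F (adjust 1F (fork-ʳ++ (subst (_≤ m) (sym (length-reverse xs)) len))
    (ʳ++-ʳ++ xs)) (ʳ++-ʳ++ xs)

-- The detour through the scratch stack reverses twice, so the original and the copy both end up in
-- the right order.
copyᵖ : Program 3
copyᵖ = move 0F 1F ⨾ fork 1F 0F 2F

copy : Fin k → Fin k → Fin k → Program k
copy x z y = use (x ∷ z ∷ y ∷ []) copyᵖ

copy-++ : length xs ≤ m →
          Run m copyᵖ (xs ∷ [] ∷ ys ∷ []) (xs ∷ [] ∷ (xs ++ ys) ∷ [])
copy-++ {xs = xs} len =
  on (0F ∷ 1F ∷ []) (move-ʳ++ len) ►
  adjust 0F (on (1F ∷ 0F ∷ 2F ∷ []) (fork-restore len)) (++-identityʳ xs)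

copy-all : length xs ≤ m →
           Run m copyᵖ (xs ∷ [] ∷ [] ∷ []) (xs ∷ [] ∷ xs ∷ [])
copy-all {xs = xs} len = adjust 2F (copy-++ len) (++-identityʳ xs)

-- Loops over a stack as a counter

-- Only the length of the counter stack matters; its bits wait on the scratch stack and are put back
-- after the loop.
takeBits-bodyᵖ : Program 4
takeBits-bodyᵖ = transfer 0F 1F ⨾ transfer 2F 3F

takeBitsᵖ : Program 4
takeBitsᵖ = while 0F nonempty takeBits-bodyᵖ ⨾ move 1F 0F

takeBits : Fin k → Fin k → Fin k → Fin k → Program k
takeBits c z x y = use (c ∷ z ∷ x ∷ y ∷ []) takeBitsᵖ

takeBits-take : length cs ≤ m →
  Run m takeBitsᵖ (cs ∷ [] ∷ xs ∷ ys ∷ [])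
                  (cs ∷ [] ∷ drop (length cs) xs ∷ (take (length cs) xs ʳ++ ys) ∷ [])
takeBits-take {cs = cs} {m = m} {xs = xs} len =
  rounds len (go cs xs) ► on (1F ∷ 0F ∷ []) (restore-all len)
  where
  -- A mask may have more bars than there are rows; once the rows have run out, `transfer` moves
  -- nothing.
  go-[] : ∀ cs {zs ys} → Loop m 0F nonempty takeBits-bodyᵖ (length cs)
          (cs ∷ zs ∷ [] ∷ ys ∷ []) ([] ∷ (cs ʳ++ zs) ∷ [] ∷ ys ∷ [])
  go-[] []       = exit refl
  go-[] (c ∷ cs) =
    refl again on (0F ∷ 1F ∷ []) transfer-∷ ► on (2F ∷ 3F ∷ []) transfer-[] then go-[] cs

  go : ∀ cs xs {zs ys} → Loop m 0F nonempty takeBits-bodyᵖ (length cs)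
       (cs ∷ zs ∷ xs ∷ ys ∷ [])
       ([] ∷ (cs ʳ++ zs) ∷ drop (length cs) xs ∷ (take (length cs) xs ʳ++ ys) ∷ [])
  go [] xs             = exit refl
  go (c ∷ cs) (x ∷ xs) =
    refl again on (0F ∷ 1F ∷ []) transfer-∷ ► on (2F ∷ 3F ∷ []) transfer-∷ then go cs xs
  go (c ∷ cs) []       =
    refl again on (0F ∷ 1F ∷ []) transfer-∷ ► on (2F ∷ 3F ∷ []) transfer-[] then go-[] cs

fill-bodyᵖ : Bool → Program 3
fill-bodyᵖ b = transfer 0F 1F ⨾ push 2F b

fillᵖ : Bool → Program 3
fillᵖ b = while 0F nonempty (fill-bodyᵖ b) ⨾ move 1F 0F

fill : Bool → Fin k → Fin k → Fin k → Program k
fill b c z t = use (c ∷ z ∷ t ∷ []) (fillᵖ b)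

fill-replicate : ∀ {a} → length cs ≡ a → a ≤ m →
  Run m (fillᵖ b) (cs ∷ [] ∷ ts ∷ []) (cs ∷ [] ∷ (replicate a b ʳ++ ts) ∷ [])
fill-replicate {cs = cs} {m = m} {b = b} refl len =
  rounds len (go cs) ► on (1F ∷ 0F ∷ []) (restore-all len)
  where
  go : ∀ cs {zs ts} → Loop m 0F nonempty (fill-bodyᵖ b) (length cs)
       (cs ∷ zs ∷ ts ∷ []) ([] ∷ (cs ʳ++ zs) ∷ (replicate (length cs) b ʳ++ ts) ∷ [])
  go []       = exit refl
  go (c ∷ cs) = refl again on (0F ∷ 1F ∷ []) transfer-∷ ► pushed then go cs

dropAllᵖ : Program 1
dropAllᵖ = while 0F nonempty (pop 0F)

dropAll : Fin k → Program k
dropAll x = use (x ∷ []) dropAllᵖ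

dropAll-[] : length xs ≤ m → Run m dropAllᵖ (xs ∷ []) ([] ∷ [])
dropAll-[] {xs = xs} len = rounds len (go xs)
  where
  go : ∀ xs → Loop _ 0F nonempty (pop 0F) (length xs) (xs ∷ []) ([] ∷ [])
  go []       = exit refl
  go (x ∷ xs) = refl again popped then go xs

-- The last stack receives a zero per vertex. After both graphs have been read it holds n zeros: n
-- in unary and at the same time the first mask.
readUnary-bodyᵖ : Program 3
readUnary-bodyᵖ = pop 0F ⨾ push 1F true ⨾ push 2F false

readUnaryᵖ : Program 3
readUnaryᵖ = while 0F isTrue readUnary-bodyᵖ ⨾ pop 0F

replicate-ʳ++ : ∀ a c (x : A) → replicate a x ʳ++ replicate c x ≡ replicate (a + c) x
replicate-ʳ++ zero    c x = refl
replicate-ʳ++ (suc a) c x =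
  trans (replicate-ʳ++ a (suc c) x) (cong (λ d → replicate d x) (+-suc a c))

readUnary-replicate : ∀ {a c c′ d d′} → a + c ≡ c′ → a + d ≡ d′ → a ≤ m →
  Run m readUnaryᵖ
    ((replicate a true ++ false ∷ xs) ∷ replicate c true ∷ replicate d false ∷ [])
    (xs ∷ replicate c′ true ∷ replicate d′ false ∷ [])
readUnary-replicate {m = m} {xs = xs} {a = a} {c} {d = d} refl refl a≤m =
  adjust 2F (adjust 1F (rounds a≤m (go a) ► popped)
    (replicate-ʳ++ a c true)) (replicate-ʳ++ a d false)
  where
  go : ∀ a {ys zs} → Loop m 0F isTrue readUnary-bodyᵖ a
       ((replicate a true ++ false ∷ xs) ∷ ys ∷ zs ∷ [])
       ((false ∷ xs) ∷ (replicate a true ʳ++ ys) ∷ (replicate a false ʳ++ zs) ∷ [])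
  go zero    = exit refl
  go (suc a) = refl again popped ► pushed ► pushed then go a

-- Writing the matrix of a blow-up.

-- Bars advance in the list of entries, stars read its head without
-- consuming it; d stands for the entry beyond the end.
expand : A → List Bool → List A → List A
expand d []          xs = []
expand d (true  ∷ w) xs = d ∷ expand d w (drop 1 xs)
expand d (false ∷ w) xs = Maybe.fromMaybe d (List.head xs) ∷ expand d w xs

-- What `expand` leaves over; the program must discard it so that the row stack is empty for the
-- next row.
unread : List Bool → List A → List A
unread []          xs = xs
unread (true  ∷ w) xs = unread w (drop 1 xs)
unread (false ∷ w) xs = unread w xs

length-unread : ∀ w (xs : List A) → length (unread w xs) ≤ length xs
length-unread []          xs       = ≤-refl
length-unread (true  ∷ w) []       = length-unread w []
length-unread (true  ∷ w) (x ∷ xs) = m≤n⇒m≤1+n (length-unread w xs)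
length-unread (false ∷ w) xs       = length-unread w xs

expandRow-bodyᵖ : Program 4
expandRow-bodyᵖ =
  if 0F isTrue (pop 0F ⨾ push 1F true ⨾ push 3F false ⨾ pop 2F)
               (pop 0F ⨾ push 1F false ⨾ if 2F isTrue (push 3F true) (push 3F false))

expandRowᵖ : Program 4
expandRowᵖ = while 0F nonempty expandRow-bodyᵖ ⨾ move 1F 0F ⨾ dropAll 2F

expandRow-expand : ∀ {w q t} → length w ≤ m → length q ≤ m →
  Run m expandRowᵖ (w ∷ [] ∷ q ∷ t ∷ []) (w ∷ [] ∷ [] ∷ (expand false w q ʳ++ t) ∷ [])
expandRow-expand {m = m} {w} {q} |w|≤m |q|≤m =
  rounds |w|≤m (go w q) ►
  on (1F ∷ 0F ∷ []) (restore-all |w|≤m) ►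
  on (2F ∷ []) (dropAll-[] (≤-trans (length-unread w q) |q|≤m))
  where
  go : ∀ w q {z t} → Loop m 0F nonempty expandRow-bodyᵖ (length w)
       (w ∷ z ∷ q ∷ t ∷ [])
       ([] ∷ (w ʳ++ z) ∷ unread w q ∷ (expand false w q ʳ++ t) ∷ [])
  go []          q           = exit refl
  go (true  ∷ w) q           =
    refl again then-branch refl (popped ► pushed ► pushed ► popped) then go w (drop 1 q)
  go (false ∷ w) []          =
    refl again else-branch refl (popped ► pushed ► else-branch refl pushed) then go w []
  go (false ∷ w) (true ∷ q)  =
    refl again else-branch refl (popped ► pushed ► then-branch refl pushed) then go w (true ∷ q)
  go (false ∷ w) (false ∷ q) =
    refl again else-branch refl (popped ► pushed ► else-branch refl pushed) then go w (false ∷ q)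

-- Several stars may read the same row, so the fork returns the row to the matrix besides handing
-- out a copy.
fetchRowᵖ : Program 5
fetchRowᵖ = takeBits 0F 1F 2F 3F ⨾ fork 3F 4F 2F

length-take-≤ : ∀ a (xs : List A) → length (take a xs) ≤ a
length-take-≤ a xs = subst (_≤ a) (sym (length-take a xs)) (m⊓n≤m a (length xs))

fetchRow-take : length cs ≤ m →
  Run m fetchRowᵖ (cs ∷ [] ∷ xs ∷ [] ∷ [] ∷ [])
                  (cs ∷ [] ∷ xs ∷ [] ∷ take (length cs) xs ∷ [])
fetchRow-take {cs = cs} {xs = xs} len =
  on (0F ∷ 1F ∷ 2F ∷ 3F ∷ []) (takeBits-take len) ►
  adjust 4F (adjust 2F
    (on (3F ∷ 4F ∷ 2F ∷ []) (fork-restore (≤-trans (length-take-≤ (length cs) xs) len)))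
    (take++drop≡id (length cs) xs)) (++-identityʳ (take (length cs) xs))

take-length-++ : ∀ (xs ys : List A) → take (length xs) (xs ++ ys) ≡ xs
take-length-++ []       ys = refl
take-length-++ (x ∷ xs) ys = cong (x ∷_) (take-length-++ xs ys)

drop-length-++ : ∀ (xs ys : List A) → drop (length xs) (xs ++ ys) ≡ ys
drop-length-++ []       ys = refl
drop-length-++ (x ∷ xs) ys = drop-length-++ xs ys

take-concat : ∀ {a} {xss : List (List A)} → All ((a ≡_) ∘ length) xss →
              take a (concat xss) ≡ Maybe.fromMaybe [] (List.head xss)
take-concat {a = a} []           = take-[] a
take-concat {xss = xs ∷ xss} (refl ∷ _) = take-length-++ xs (concat xss)

drop-concat : ∀ {a} {xss : List (List A)} → All ((a ≡_) ∘ length) xss →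
              drop a (concat xss) ≡ concat (drop 1 xss)
drop-concat {a = a} []           = drop-[] a
drop-concat {xss = xs ∷ xss} (refl ∷ _) = drop-length-++ xs (concat xss)

-- Stacks: the mask to be consumed, the mask, h, the rows, the rows already
-- passed, two stacks for a row, scratch, the output.
blowup-bodyᵖ blowupᵖ : Program 9
blowup-bodyᵖ =
  if 0F isTrue (pop 0F ⨾ takeBits 2F 7F 3F 4F)
               (pop 0F ⨾ use (2F ∷ 7F ∷ 3F ∷ 5F ∷ 6F ∷ []) fetchRowᵖ) ⨾
  use (1F ∷ 7F ∷ 6F ∷ 8F ∷ []) expandRowᵖ
blowupᵖ = while 0F nonempty blowup-bodyᵖ ⨾ move 4F 3F

expandRows : List Bool → List (List Bool) → List Bool
expandRows w rows = concat (List.map (expand false w) (expand [] w rows))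

blowup-expandRows : ∀ {w hs rows t} → All ((length hs ≡_) ∘ length) rows →
  length w ≤ m → length hs ≤ m → length (concat rows) ≤ m →
  Run m blowupᵖ (w ∷ w ∷ hs ∷ concat rows ∷ [] ∷ [] ∷ [] ∷ [] ∷ t ∷ [])
    ([] ∷ w ∷ hs ∷ concat rows ∷ [] ∷ [] ∷ [] ∷ [] ∷ (expandRows w rows ʳ++ t) ∷ [])
blowup-expandRows {m = m} {w} {hs} {rows} {t} eq |w|≤m |hs|≤m |rows|≤m
  with go w rows (concat rows) [] t refl eq
  where
  -- The invariant is `s ʳ++ hp`, the whole matrix of `H`: passed rows lie reversed on `s`, and the
  -- final move restores them.
  go : ∀ v rows hp s t → hp ≡ concat rows → All ((length hs ≡_) ∘ length) rows →
       ∃[ hp′ ] ∃[ s′ ] ∃[ t′ ] s′ ʳ++ hp′ ≡ s ʳ++ hp ×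
       t′ ≡ concat (List.map (expand false w) (expand [] v rows)) ʳ++ t ×
       Loop m 0F nonempty blowup-bodyᵖ (length v)
         (v ∷ w ∷ hs ∷ hp ∷ s ∷ [] ∷ [] ∷ [] ∷ t ∷ [])
         ([] ∷ w ∷ hs ∷ hp′ ∷ s′ ∷ [] ∷ [] ∷ [] ∷ t′ ∷ [])
  go [] rows hp s t hp≡ eq = hp , s , t , refl , refl , exit refl
  go (true ∷ v) rows hp s t hp≡ eq
    with go v (drop 1 rows) (drop (length hs) hp) (take (length hs) hp ʳ++ s)
            (expand false w [] ʳ++ t) (trans (cong (drop (length hs)) hp≡) (drop-concat eq))
            (drop⁺ 1 eq)
  ... | hp′ , s′ , t′ , s′≡ , t′≡ , l =
    hp′ , s′ , t′ ,
    trans s′≡ (trans (ʳ++-ʳ++ (take (length hs) hp))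
                     (cong (s ʳ++_) (take++drop≡id (length hs) hp))) ,
    trans t′≡ (sym (++-ʳ++ (expand false w []))) ,
    (refl again then-branch refl
       (popped ► on (2F ∷ 7F ∷ 3F ∷ 4F ∷ []) (takeBits-take |hs|≤m)) ►
       -- A bar is an isolated position: the row stack is empty, and the empty row expands to zeros.
       on (1F ∷ 7F ∷ 6F ∷ 8F ∷ []) (expandRow-expand |w|≤m z≤n)
     then l)
  go (false ∷ v) rows hp s t hp≡ eq
    with go v rows hp s (expand false w (take (length hs) hp) ʳ++ t) hp≡ eq
  ... | hp′ , s′ , t′ , s′≡ , t′≡ , l =
    hp′ , s′ , t′ , s′≡ ,
    trans t′≡ (trans
      (cong (λ r → concat (List.map (expand false w) (expand [] v rows)) ʳ++ (expand false w r ʳ++ t))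
            (trans (cong (take (length hs)) hp≡) (take-concat eq)))
      (sym (++-ʳ++ (expand false w (Maybe.fromMaybe [] (List.head rows)))))) ,
    (refl again else-branch refl
       (popped ► on (2F ∷ 7F ∷ 3F ∷ 5F ∷ 6F ∷ []) (fetchRow-take |hs|≤m)) ►
       on (1F ∷ 7F ∷ 6F ∷ 8F ∷ [])
         (expandRow-expand |w|≤m (≤-trans (length-take-≤ (length hs) hp) |hs|≤m))
     then l)
... | hp′ , s′ , t′ , s′≡ , refl , l =
  rounds |w|≤m l ► adjust 3F (on (4F ∷ 3F ∷ []) (move-ʳ++ |s′|≤m)) s′≡
  where
  |s′|≤m : length s′ ≤ m
  -- By the invariant `s′` and `hp′` together are as long as the matrix.
  |s′|≤m = ≤-trans (m≤m+n (length s′) (length hp′))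
    (subst (_≤ m) (trans (cong length (sym s′≡)) (length-ʳ++ s′)) |rows|≤m)

-- The counter and the loop over all masks.

-- Binary counter, least significant bit first.
increment : List Bool → List Bool
increment []          = []
increment (true  ∷ w) = false ∷ increment w
increment (false ∷ w) = true ∷ w

-- The carry that remains after all digits. It is nonempty only when every digit was 1, and this
-- ends the counter loop.
overflow : List Bool → List Bool
overflow []          = true ∷ []
overflow (true  ∷ w) = overflow w
overflow (false ∷ w) = []

length-increment : ∀ w → length (increment w) ≡ length w
length-increment []          = refl
length-increment (true  ∷ w) = cong suc (length-increment w)
length-increment (false ∷ w) = refl

increment-bodyᵖ incrementᵖ : Program 3
increment-bodyᵖ =
  if 0F nonempty
    (if 1F isTrue (pop 1F ⨾ push 2F false) (pop 0F ⨾ pop 1F ⨾ push 2F true))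
    (transfer 1F 2F)
incrementᵖ = push 0F true ⨾ while 1F nonempty increment-bodyᵖ ⨾ move 2F 1F

increment-increment : ∀ {w} → length w ≤ m →
  Run m incrementᵖ ([] ∷ w ∷ [] ∷ []) (overflow w ∷ increment w ∷ [] ∷ [])
increment-increment {m = m} {w} |w|≤m =
  pushed ► rounds |w|≤m (carry w) ►
  on (2F ∷ 1F ∷ []) (restore-all (subst (_≤ m) (sym (length-increment w)) |w|≤m))
  where
  copying : ∀ w {z} → Loop m 1F nonempty increment-bodyᵖ (length w)
            ([] ∷ w ∷ z ∷ []) ([] ∷ [] ∷ (w ʳ++ z) ∷ [])
  copying []      = exit refl
  copying (b ∷ w) = refl again else-branch refl (on (1F ∷ 2F ∷ []) transfer-∷) then copying w

  carry : ∀ w {z} → Loop m 1F nonempty increment-bodyᵖ (length w)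
          ((true ∷ []) ∷ w ∷ z ∷ []) (overflow w ∷ [] ∷ (increment w ʳ++ z) ∷ [])
  carry []          = exit refl
  carry (true  ∷ w) =
    refl again then-branch refl (then-branch refl (popped ► pushed)) then carry w
  carry (false ∷ w) =
    refl again then-branch refl (else-branch refl (popped ► popped ► pushed)) then copying w

-- The 2 ^ j masks that extend r by j less significant bits, in the order
-- opposite to that of the counter: the output is written from the end.
masks : ∀ j → List Bool → Vec (List Bool) (2 ^ j)
masks zero    r = r ∷ []
masks (suc j) r = masks j (true ∷ r) Vec.++ masks j (false ∷ r) Vec.++ []

instanceBits : List Bool → List (List Bool) → List Bool → List Bool → List Bool
instanceBits e rows w o = e ++ expandRows w rows ++ o

-- Stacks: output, the bits e common to all instances, h, the rows of H, the
-- mask, the mask to be consumed, the overflow, and five scratch stacks.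
store : List Bool → List Bool → List (List Bool) → List Bool → List Bool → List Bool → Store 12
store e hs rows f w o =
  o ∷ e ∷ hs ∷ concat rows ∷ w ∷ [] ∷ f ∷ [] ∷ [] ∷ [] ∷ [] ∷ [] ∷ []

pattern 10F = suc 9F
pattern 11F = suc 10F

empty : Test
empty = not ∘ nonempty

-- The output grows at its front: the matrix of the blow-up, which arrives reversed, goes on top of
-- the later instances, and the common bits go on top of the matrix.
instanceᵖ : Program 12
instanceᵖ =
  copy 4F 11F 5F ⨾
  use (5F ∷ 4F ∷ 2F ∷ 3F ∷ 10F ∷ 9F ∷ 8F ∷ 11F ∷ 7F ∷ []) blowupᵖ ⨾
  move 7F 0F ⨾
  copy 1F 11F 0F ⨾
  use (6F ∷ 4F ∷ 11F ∷ []) incrementᵖ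

module _ {m n : ℕ} {e hs : List Bool} {rows : List (List Bool)}
  (eq : All ((length hs ≡_) ∘ length) rows)
  (|hs|≤m : length hs ≤ m) (|rows|≤m : length (concat rows) ≤ m) (|e|≤m : length e ≤ m)
  (n≤m : n ≤ m)
  (|out|≤m : ∀ w → length w ≡ n → length (expandRows w rows) ≤ m)
  where

  instance-instanceBits : ∀ {w o} → length w ≡ n →
    Run m instanceᵖ (store e hs rows [] w o)
      (store e hs rows (overflow w) (increment w) (instanceBits e rows w o))
  instance-instanceBits {w} {o} |w|≡n =
    on (4F ∷ 11F ∷ 5F ∷ []) (copy-all |w|≤m) ►
    on (5F ∷ 4F ∷ 2F ∷ 3F ∷ 10F ∷ 9F ∷ 8F ∷ 11F ∷ 7F ∷ [])
       (blowup-expandRows eq |w|≤m |hs|≤m |rows|≤m) ►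
    on (7F ∷ 0F ∷ []) (restore (|out|≤m w |w|≡n)) ►
    on (1F ∷ 11F ∷ 0F ∷ []) (copy-++ |e|≤m) ►
    on (6F ∷ 4F ∷ 11F ∷ []) (increment-increment |w|≤m)
    where
    |w|≤m = subst (_≤ m) (sym |w|≡n) n≤m

  -- With ʳ++ in place of ++ the digits of the counter pass between the zeros
  -- and r by computation.
  enumerate : ∀ j r {o i τ} → j + length r ≡ n →
    Loop m 6F empty instanceᵖ i
      (store e hs rows (overflow r) (replicate j false ʳ++ increment r)
        (Vec.foldr′ (instanceBits e rows) o (masks j r))) τ →
    Loop m 6F empty instanceᵖ (2 ^ j + i)
      (store e hs rows [] (replicate j false ʳ++ r) o) τ
  enumerate zero    r |r| l = refl again instance-instanceBits |r| then l
  enumerate (suc j) r {o} {i} {τ} |r| l =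
    subst (λ i → Loop m 6F empty instanceᵖ i (store e hs rows [] (replicate (suc j) false ʳ++ r) o) τ)
      rearrange
      -- The half with digit 0 ends when a carry turns this digit into 1; the half with digit 1 ends
      -- when a carry reaches `r`.
      (enumerate j (false ∷ r) |r|′
        (enumerate j (true ∷ r) |r|′
          (subst (λ o → Loop m 6F empty instanceᵖ i
                          (store e hs rows _ (replicate (suc j) false ʳ++ increment r) o) τ)
            foldr-masks l)))
    where
    |r|′ : j + suc (length r) ≡ n
    |r|′ = trans (+-suc j (length r)) |r|
    rearrange : 2 ^ j + (2 ^ j + i) ≡ 2 ^ suc j + i
    rearrange = trans (sym (+-assoc (2 ^ j) (2 ^ j) i))
                      (cong (λ a → 2 ^ j + a + i) (sym (+-identityʳ (2 ^ j))))
    foldr-masks : Vec.foldr′ (instanceBits e rows) o (masks (suc j) r) ≡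
      Vec.foldr′ (instanceBits e rows)
        (Vec.foldr′ (instanceBits e rows) o (masks j (false ∷ r))) (masks j (true ∷ r))
    foldr-masks = trans (Vec.foldr-++ _ (instanceBits e rows) (masks j (true ∷ r)))
      (cong (λ o → Vec.foldr′ (instanceBits e rows) o (masks j (true ∷ r)))
            (Vec.foldr-++ _ (instanceBits e rows) (masks j (false ∷ r))))

-- Reading the input and writing the bits common to all instances.

takeBits-prefix : length cs ≡ length xs → length cs ≤ m →
  Run m takeBitsᵖ (cs ∷ [] ∷ (xs ++ ys) ∷ zs ∷ []) (cs ∷ [] ∷ ys ∷ (xs ʳ++ zs) ∷ [])
takeBits-prefix {cs = cs} {xs = xs} {ys = ys} {zs = zs} eq len =
  adjust 3F (adjust 2F (takeBits-take len)
    (trans (cong (λ a → drop a (xs ++ ys)) eq) (drop-length-++ xs ys)))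
    (cong (_ʳ++ zs) (trans (cong (λ a → take a (xs ++ ys)) eq) (take-length-++ xs ys)))

-- Stacks: input, g, h, counter, output, scratch.
readRows-bodyᵖ readRowsᵖ : Program 6
readRows-bodyᵖ = pop 3F ⨾ takeBits 1F 5F 0F 4F ⨾ fill false 2F 5F 4F
readRowsᵖ = copy 1F 5F 3F ⨾ while 3F nonempty readRows-bodyᵖ

padRows : ℕ → List (List Bool) → List (List Bool)
padRows h = List.map (_++ replicate h false)

-- The input is a right fold of `_++_`, not a concatenation followed by `rest`, so that the next row
-- splits off by computation.
readRows-padRows : ∀ {cs hs rows rest t} → length hs ≡ h →
  All ((length cs ≡_) ∘ length) rows → length cs ≡ length rows → length cs ≤ m → h ≤ m →
  Run m readRowsᵖ (List.foldr _++_ rest rows ∷ cs ∷ hs ∷ [] ∷ t ∷ [] ∷ [])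
                  (rest ∷ cs ∷ hs ∷ [] ∷ (concat (padRows h rows) ʳ++ t) ∷ [] ∷ [])
readRows-padRows {h = h} {m = m} {cs} {hs} {rows} {rest} |hs| eq |rows| |cs|≤m h≤m =
  on (1F ∷ 5F ∷ 3F ∷ []) (copy-all |cs|≤m) ► rounds |cs|≤m (go cs rows |rows| eq)
  where
  go : ∀ xs rows {t} → length xs ≡ length rows → All ((length cs ≡_) ∘ length) rows →
       Loop m 3F nonempty readRows-bodyᵖ (length xs)
         (List.foldr _++_ rest rows ∷ cs ∷ hs ∷ xs ∷ t ∷ [] ∷ [])
         (rest ∷ cs ∷ hs ∷ [] ∷ (concat (padRows h rows) ʳ++ t) ∷ [] ∷ [])
  go []       []         |xs| []         = exit refl
  go (x ∷ xs) (r ∷ rows) {t} |xs| (|r| ∷ eq) =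
    refl again popped ►
      on (1F ∷ 5F ∷ 0F ∷ 4F ∷ []) (takeBits-prefix |r| |cs|≤m) ►
      on (2F ∷ 5F ∷ 4F ∷ []) (fill-replicate |hs| h≤m)
    then adjustᴸ 4F (go xs rows (suc-injective |xs|) eq)
      (sym (trans (++-ʳ++ (r ++ replicate h false))
                  (cong (concat (padRows h rows) ʳ++_) (++-ʳ++ r))))

repeatᵖ : Program 4 → Program 4
repeatᵖ P = while 0F nonempty (pop 0F ⨾ P)

repeat-replicate : ∀ {P cs t block a} →
  (∀ {xs t} → Run m P (xs ∷ cs ∷ [] ∷ t ∷ []) (xs ∷ cs ∷ [] ∷ (block ʳ++ t) ∷ [])) →
  length xs ≡ a → a ≤ m →
  Run m (repeatᵖ P) (xs ∷ cs ∷ [] ∷ t ∷ [])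
                    ([] ∷ cs ∷ [] ∷ (concat (replicate a block) ʳ++ t) ∷ [])
repeat-replicate {m = m} {xs = xs} {P} {cs} {block = block} body refl len = rounds len (go xs)
  where
  go : ∀ xs {t} → Loop m 0F nonempty (pop 0F ⨾ P) (length xs)
       (xs ∷ cs ∷ [] ∷ t ∷ [])
       ([] ∷ cs ∷ [] ∷ (concat (replicate (length xs) block) ʳ++ t) ∷ [])
  go []           = exit refl
  go (x ∷ xs) {t} =
    refl again popped ► body
    then adjustᴸ 3F (go xs) (sym (++-ʳ++ block))

star-rowᵖ : Program 4
star-rowᵖ = push 3F true ⨾ fill false 1F 2F 3F

-- Stacks: input, g, h, n, counter, output, scratch.
padᵖ starᵖ sourceᵖ : Program 7
padᵖ =
  use (0F ∷ 1F ∷ 2F ∷ 4F ∷ 5F ∷ 6F ∷ []) readRowsᵖ ⨾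
  copy 2F 6F 4F ⨾
  use (4F ∷ 3F ∷ 6F ∷ 5F ∷ []) (repeatᵖ (fill false 1F 2F 3F))
starᵖ =
  dropAll 0F ⨾
  if 1F nonempty
    (pop 1F ⨾ push 5F false ⨾ fill true 1F 6F 5F ⨾ copy 1F 6F 4F ⨾
     use (4F ∷ 1F ∷ 6F ∷ 5F ∷ []) (repeatᵖ star-rowᵖ))
    skip
sourceᵖ = if 2F nonempty padᵖ starᵖ ⨾ dropAll 1F

-- The adjacency matrix of the star graph with centre 0; this star is unrelated to the stars of a
-- mask.
starBits : ℕ → List Bool
starBits zero    = []
starBits (suc g) = false ∷ replicate g true ++ concat (replicate g (true ∷ replicate g false))

sourceBits : ℕ → ℕ → List (List Bool) → List Bool
sourceBits g zero    rows = starBits g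
sourceBits g (suc h) rows =
  concat (padRows (suc h) rows) ++
  concat (replicate (suc h) (replicate (g + suc h) false))

-- For `h = 0` the program empties the whole input stack instead of reading rows; nothing is lost,
-- as the matrix of `H` is then empty.
source-sourceBits : ∀ {rows rest ns t} → (h ≡ 0 → rest ≡ []) → length ns ≡ g + h →
  All ((g ≡_) ∘ length) rows → g ≡ length rows → g + h ≤ m → length (concat rows) ≤ m →
  Run m sourceᵖ
    (List.foldr _++_ rest rows ∷ replicate g true ∷ replicate h true ∷ ns ∷ [] ∷ t ∷ [] ∷ [])
    (rest ∷ [] ∷ replicate h true ∷ ns ∷ [] ∷ (sourceBits g h rows ʳ++ t) ∷ [] ∷ [])
source-sourceBits {zero} {zero} {m} {rows} {rest} {ns} {t} eq |ns| |r| |rows| n≤m |rows|≤m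
  rewrite eq refl =
  else-branch refl (on (0F ∷ []) (dropAll-[] |rows|≤m) ► else-branch refl skipped) ►
  on (1F ∷ []) (dropAll-[] z≤n)
source-sourceBits {zero} {suc g} {m} {rows} {rest} {ns} {t} eq |ns| |r| |rows| n≤m |rows|≤m
  rewrite eq refl =
  else-branch refl
    (on (0F ∷ []) (dropAll-[] |rows|≤m) ►
     then-branch refl
       -- The pop sets the centre apart, leaving the number of the other vertices.
       (popped ► pushed ►
        on (1F ∷ 6F ∷ 5F ∷ []) (fill-replicate (length-replicate g) g≤m) ►
        on (1F ∷ 6F ∷ 4F ∷ []) (copy-all |ones|≤m) ►
        adjust 5F
          (on (4F ∷ 1F ∷ 6F ∷ 5F ∷ [])
            (repeat-replicate {P = star-rowᵖ} {block = true ∷ replicate g false}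
              (pushed ► on (1F ∷ 2F ∷ 3F ∷ []) (fill-replicate (length-replicate g) g≤m))
              (length-replicate g) g≤m))
          (sym (++-ʳ++ (replicate g true))))) ►
  on (1F ∷ []) (dropAll-[] |ones|≤m)
  where
  g≤m : g ≤ m
  g≤m = ≤-trans (m≤n⇒m≤1+n (m≤m+n g 0)) n≤m
  |ones|≤m : length (replicate g true) ≤ m
  |ones|≤m = ≤-trans (≤-reflexive (length-replicate g)) g≤m
source-sourceBits {suc h} {g} {m} {rows} {rest} {ns} {t} eq |ns| |r| |rows| n≤m |rows|≤m =
  then-branch refl
    (on (0F ∷ 1F ∷ 2F ∷ 4F ∷ 5F ∷ 6F ∷ [])
       (readRows-padRows (length-replicate (suc h))
         (subst (λ a → All ((a ≡_) ∘ length) rows) (sym (length-replicate g)) |r|)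
         (trans (length-replicate g) |rows|) |g|≤m h≤m) ►
     on (2F ∷ 6F ∷ 4F ∷ []) (copy-all (≤-trans (≤-reflexive (length-replicate (suc h))) h≤m)) ►
     adjust 5F
       (on (4F ∷ 3F ∷ 6F ∷ 5F ∷ [])
         (repeat-replicate {P = fill false 1F 2F 3F} {block = replicate (g + suc h) false}
           (on (1F ∷ 2F ∷ 3F ∷ []) (fill-replicate |ns| n≤m))
           (length-replicate (suc h)) h≤m))
       (sym (++-ʳ++ (concat (padRows (suc h) rows))))) ►
  on (1F ∷ []) (dropAll-[] |g|≤m)
  where
  h≤m : suc h ≤ m
  h≤m = ≤-trans (m≤n+m (suc h) g) n≤m
  |g|≤m : length (replicate g true) ≤ m
  |g|≤m = ≤-trans (≤-reflexive (length-replicate g)) (≤-trans (m≤m+n g (suc h)) n≤m)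

-- Padding by no columns only passes over the rows. The parser does this to reach the vertex number
-- of `H`, and then puts the rows back.
concat-padRows-0 : ∀ rows xs → concat (padRows 0 rows) ++ xs ≡ List.foldr _++_ xs rows
concat-padRows-0 []         xs = refl
concat-padRows-0 (r ∷ rows) xs =
  trans (++-assoc (r ++ []) (concat (padRows 0 rows)) xs)
        (cong₂ _++_ (++-identityʳ r) (concat-padRows-0 rows xs))

-- All of an instance that precedes the matrix of its target: the bit 1, the encoded source graph
-- with matrix `bits`, and the vertex number of the target.
prefix : ℕ → List Bool → List Bool
prefix n bits = true ∷ replicate n true ++ false ∷ bits ++ replicate n true ++ false ∷ []

parseᵖ prefixᵖ setupᵖ : Program 12
parseᵖ =
  use (0F ∷ 8F ∷ 4F ∷ []) readUnaryᵖ ⨾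
  use (0F ∷ 8F ∷ 2F ∷ 5F ∷ 9F ∷ 11F ∷ []) readRowsᵖ ⨾
  use (0F ∷ 2F ∷ 4F ∷ []) readUnaryᵖ ⨾
  move 9F 0F
prefixᵖ =
  push 7F true ⨾ fill true 4F 11F 7F ⨾ push 7F false ⨾
  use (0F ∷ 8F ∷ 2F ∷ 4F ∷ 5F ∷ 7F ∷ 11F ∷ []) sourceᵖ ⨾
  fill true 4F 11F 7F ⨾ push 7F false
setupᵖ =
  parseᵖ ⨾ prefixᵖ ⨾
  -- The rows of `H` are moved twice to keep their order. The bit 0 that ends the list is written
  -- first, as the output grows at its front.
  move 7F 1F ⨾ move 0F 9F ⨾ move 9F 3F ⨾ push 0F false

input : ℕ → List (List Bool) → ℕ → List Bool → List Bool
input g rows h bits =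
  replicate g true ++ false ∷ List.foldr _++_ (replicate h true ++ false ∷ bits) rows

module _ {m g h : ℕ} {rows : List (List Bool)}
  (|r| : All ((g ≡_) ∘ length) rows) (|rows| : g ≡ length rows)
  (n≤m : g + h ≤ m) (|rows|≤m : length (concat rows) ≤ m) where

  private
    g≤m : g ≤ m
    g≤m = ≤-trans (m≤m+n g h) n≤m

    |g|≡ : length (replicate g true) ≡ g
    |g|≡ = length-replicate g

  parse-input : ∀ {bits} →
    Run m parseᵖ (input g rows h bits ∷ Vec.replicate 11 [])
      (List.foldr _++_ bits rows ∷ [] ∷ replicate h true ∷ [] ∷ replicate (g + h) false ∷
       [] ∷ [] ∷ [] ∷ replicate g true ∷ [] ∷ [] ∷ [] ∷ [])
  parse-input {bits} =
    on (0F ∷ 8F ∷ 4F ∷ []) (readUnary-replicate {c = 0} {d = 0} (+-identityʳ g) (+-identityʳ g) g≤m) ►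
    on (0F ∷ 8F ∷ 2F ∷ 5F ∷ 9F ∷ 11F ∷ [])
      (readRows-padRows refl
        (subst (λ a → All ((a ≡_) ∘ length) rows) (sym |g|≡) |r|) (trans |g|≡ |rows|)
        (≤-trans (≤-reflexive |g|≡) g≤m) z≤n) ►
    on (0F ∷ 2F ∷ 4F ∷ [])
      (readUnary-replicate {c = 0} {d = g} (+-identityʳ h) (+-comm h g)
        (≤-trans (m≤n+m h g) n≤m)) ►
    adjust 0F
      (on (9F ∷ 0F ∷ [])
        (restore (subst (λ xs → length xs ≤ m)
          (trans (sym (concat-padRows-0 rows [])) (++-identityʳ _)) |rows|≤m)))
      (concat-padRows-0 rows bits)

  prefix-prefix : ∀ {bits} → (h ≡ 0 → bits ≡ []) →
    Run m prefixᵖ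
      (List.foldr _++_ bits rows ∷ [] ∷ replicate h true ∷ [] ∷ replicate (g + h) false ∷
       [] ∷ [] ∷ [] ∷ replicate g true ∷ [] ∷ [] ∷ [] ∷ [])
      (bits ∷ [] ∷ replicate h true ∷ [] ∷ replicate (g + h) false ∷
       [] ∷ [] ∷ (prefix (g + h) (sourceBits g h rows) ʳ++ []) ∷ [] ∷ [] ∷ [] ∷ [] ∷ [])
  prefix-prefix {bits} eq =
    adjust 7F
      (pushed ►
       on (4F ∷ 11F ∷ 7F ∷ []) (fill-replicate |ns| n≤m) ►
       pushed ►
       on (0F ∷ 8F ∷ 2F ∷ 4F ∷ 5F ∷ 7F ∷ 11F ∷ [])
         (source-sourceBits eq |ns| |r| |rows| n≤m |rows|≤m) ►
       on (4F ∷ 11F ∷ 7F ∷ []) (fill-replicate |ns| n≤m) ►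
       pushed)
      (sym (trans (++-ʳ++ (replicate (g + h) true))
           (trans (++-ʳ++ (sourceBits g h rows)) (++-ʳ++ (replicate (g + h) true)))))
    where
    |ns| : length (replicate (g + h) false) ≡ g + h
    |ns| = length-replicate (g + h)

  setup-store : ∀ {rowsH} → (h ≡ 0 → concat rowsH ≡ []) → length (concat rowsH) ≤ m →
    length (prefix (g + h) (sourceBits g h rows)) ≤ m →
    Run m setupᵖ (input g rows h (concat rowsH) ∷ Vec.replicate 11 [])
      (store (prefix (g + h) (sourceBits g h rows)) (replicate h true) rowsH
             [] (replicate (g + h) false) (false ∷ []))
  setup-store eq |rowsH|≤m |prefix|≤m =
    parse-input ► prefix-prefix eq ►
    on (7F ∷ 1F ∷ []) (restore-all |prefix|≤m) ►
    on (0F ∷ 9F ∷ []) (move-ʳ++ |rowsH|≤m) ►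
    on (9F ∷ 3F ∷ []) (restore-all |rowsH|≤m) ►
    pushed

-- Blow-ups

link : Graph h → Maybe (Fin h) → Maybe (Fin h) → Bool
link H (just i) (just j) = adj H i j
link H (just i) nothing  = false
link H nothing  j        = false

link-just : ∀ (H : Graph h) i j → Maybe.maybe′ (adj H i) false j ≡ link H (just i) j
link-just H i (just j) = refl
link-just H i nothing  = refl

link-symm : ∀ (H : Graph h) i j → link H i j ≡ link H j i
link-symm H (just i) (just j) = symm H i j
link-symm H (just i) nothing  = refl
link-symm H nothing  (just j) = refl
link-symm H nothing  nothing  = refl

link-irrefl : ∀ (H : Graph h) i → link H i i ≡ false
link-irrefl H (just i) = irrefl H i
link-irrefl H nothing  = refl

link-edge : ∀ (H : Graph h) {d} i j → T (link H i j) →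
            Edge H (Maybe.fromMaybe d i) (Maybe.fromMaybe d j)
link-edge H (just i) (just j) e = e

-- Positions mapped to `nothing` are isolated. Along `left` this is padding by isolated vertices,
-- along `block` it is the blow-up.
pullback : Graph h → (Fin n → Maybe (Fin h)) → Graph n
pullback H β = record
  { adj    = λ u v → link H (β u) (β v)
  ; symm   = λ u v → link-symm H (β u) (β v)
  ; irrefl = λ u → link-irrefl H (β u)
  }

isZero : Fin n → Bool
isZero zero    = true
isZero (suc _) = false

starGraph : ∀ n → Graph n
starGraph n = record
  { adj    = λ u v → isZero u xor isZero v
  ; symm   = λ u v → xor-comm (isZero u) (isZero v)
  ; irrefl = λ u → xor-same (isZero u)
  }

-- The partial inverse of `_↑ˡ h`.
left : ∀ g → Fin (g + h) → Maybe (Fin g)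
left zero    u       = nothing
left (suc g) zero    = just zero
left (suc g) (suc u) = Maybe.map suc (left g u)

left-↑ˡ : ∀ h (u : Fin g) → left g (u ↑ˡ h) ≡ just u
left-↑ˡ h zero    = refl
left-↑ˡ h (suc u) = cong (Maybe.map suc) (left-↑ˡ h u)

left-just : ∀ g (u : Fin (g + h)) {i} → left g u ≡ just i → i ↑ˡ h ≡ u
left-just (suc g) zero    refl = refl
left-just (suc g) (suc u) eq with left g u in eq′
left-just (suc g) (suc u) refl | just i = cong suc (left-just g u eq′)

-- The star at position u belongs to the block numbered by the bars before it.
block : ∀ h → List Bool → Fin n → Maybe (Fin h)
block h       []          u       = nothing
block zero    (false ∷ w) zero    = nothing
block (suc h) (false ∷ w) zero    = just zero
block h       (false ∷ w) (suc u) = block h w u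
block h       (true ∷ w)  zero    = nothing
block zero    (true ∷ w)  (suc u) = block zero w u
block (suc h) (true ∷ w)  (suc u) = Maybe.map suc (block h w u)

-- For h = 0 all targets are edgeless, and G may be edgeless as well: a graph
-- with an edge takes its place.
source : Graph g → ∀ h → Graph (g + h)
source {g} G zero    = starGraph (g + 0)
source {g} G (suc h) = pullback G (left g)

target : Graph h → List Bool → Graph n
target {h} H w = pullback H (block h w)

-- Matrices of blow-ups

rows : Graph n → List (List Bool)
rows G = tabulate λ u → tabulate (adj G u)

length-concat-tabulate : ∀ p {q} (φ : Fin p → Fin q → A) →
  length (concat (tabulate λ u → tabulate (φ u))) ≡ p * q
length-concat-tabulate zero    φ = refl
length-concat-tabulate (suc p) φ =
  trans (length-++ (tabulate (φ zero)))
        (cong₂ _+_ (length-tabulate (φ zero)) (length-concat-tabulate p (φ ∘ suc)))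

rows-All : (G : Graph n) → All ((n ≡_) ∘ length) (rows G)
rows-All G = tabulate⁺ λ u → sym (length-tabulate (adj G u))

tabulate-const : ∀ n (x : A) → tabulate {n = n} (const x) ≡ replicate n x
tabulate-const zero    x = refl
tabulate-const (suc n) x = cong (x ∷_) (tabulate-const n x)

-- Links the program to `block`: dropping an entry at a bar precomposes the table with `suc`, just
-- as the bar raises all later block numbers.
expand-tabulate : ∀ w (d : A) (φ : Fin h → A) → length w ≡ n →
  expand d w (tabulate φ) ≡ tabulate {n = n} (λ u → Maybe.maybe′ φ d (block h w u))
expand-tabulate               []          d φ refl = refl
expand-tabulate {h = zero}    (true  ∷ w) d φ refl = cong (d ∷_) (expand-tabulate w d φ refl)
expand-tabulate {h = suc h}   (true  ∷ w) d φ refl =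
  cong (d ∷_) (trans (expand-tabulate w d (φ ∘ suc) refl)
    (tabulate-cong λ u → sym (maybe′-map φ d suc (block h w u))))
expand-tabulate {h = zero}    (false ∷ w) d φ refl = cong (d ∷_) (expand-tabulate w d φ refl)
expand-tabulate {h = suc h}   (false ∷ w) d φ refl = cong (φ zero ∷_) (expand-tabulate w d φ refl)

expandRows-target : ∀ (H : Graph h) w → length w ≡ n →
  expandRows w (rows H) ≡ concat (rows (target {n = n} H w))
expandRows-target {h = h} {n = n} H w |w| = cong concat
  (trans (cong (List.map (expand false w)) (expand-tabulate w [] (λ i → tabulate (adj H i)) |w|))
  (trans (map-tabulate _ (expand false w))
         (tabulate-cong λ u → row (block h w u))))
  where
  row : ∀ i → expand false w (Maybe.maybe′ (λ i → tabulate (adj H i)) [] i) ≡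
              tabulate (λ v → link H i (block h w v))
  row (just i) = trans (expand-tabulate w false (adj H i) |w|)
                       (tabulate-cong λ v → link-just H i (block h w v))
  -- The default row is a table without entries, for which no position lies in a block.
  row nothing  = trans (expand-tabulate {h = 0} w false (λ ()) |w|)
                       (tabulate-cong λ v → nowhere (block 0 w v))
    where
    nowhere : ∀ (i : Maybe (Fin 0)) → Maybe.maybe′ (λ ()) false i ≡ false
    nowhere nothing = refl

left-tabulate : ∀ g (d : A) (φ : Fin g → A) →
  tabulate {n = g + h} (λ u → Maybe.maybe′ φ d (left g u)) ≡ tabulate φ ++ replicate h d
left-tabulate {h = h} zero d φ = tabulate-const h d
left-tabulate (suc g) d φ = cong (φ zero ∷_)
  (trans (tabulate-cong λ u → maybe′-map φ d suc (left g u)) (left-tabulate g d (φ ∘ suc)))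

pad-left : ∀ (G : Graph g) h →
  concat (padRows h (rows G)) ++ concat (replicate h (replicate (g + h) false)) ≡
  concat (rows (pullback G (left {h = h} g)))
pad-left {g} G h =
  trans (concat-++ (padRows h (rows G)) (replicate h (replicate (g + h) false)))
    (cong concat
      (trans (cong (_++ replicate h (replicate (g + h) false))
               (map-tabulate (λ u → tabulate (adj G u)) (_++ replicate h false)))
      (trans (sym (left-tabulate g (replicate (g + h) false) (λ i → tabulate (adj G i) ++ replicate h false)))
             (tabulate-cong λ u → row (left g u)))))
  where
  row : ∀ i → Maybe.maybe′ (λ i → tabulate (adj G i) ++ replicate h false)
                (replicate (g + h) false) i ≡
              tabulate {n = g + h} (λ v → link G i (left g v))
  row (just i) = trans (sym (left-tabulate g false (adj G i)))
                       (tabulate-cong λ v → link-just G i (left g v))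
  row nothing  = sym (tabulate-const (g + h) false)

starBits-starGraph : ∀ n → starBits n ≡ concat (rows (starGraph n))
starBits-starGraph zero    = refl
starBits-starGraph (suc n) = cong (false ∷_) (cong₂ _++_ (sym (tabulate-const n true))
  (cong concat (sym (trans (tabulate-const n (true ∷ tabulate (const false)))
                           (cong (λ xs → replicate n (true ∷ xs)) (tabulate-const n false))))))

sourceBits-source : ∀ (G : Graph g) h → sourceBits g h (rows G) ≡ concat (rows (source G h))
sourceBits-source {g} G zero =
  trans (cong starBits (sym (+-identityʳ g))) (starBits-starGraph (g + 0))
sourceBits-source G (suc h) = pad-left G (suc h)

encode-instanceBits : ∀ (G : Graph g) (H : Graph h) w o → length w ≡ g + h →
  true ∷ encodePair (source G h) (target H w) ++ o ≡
  instanceBits (prefix (g + h) (sourceBits g h (rows G))) (rows H) w o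
encode-instanceBits {g} {h} G H w o |w|
  rewrite sourceBits-source G h | expandRows-target H w |w| =
  cong (true ∷_) (begin
    ((ns ++ false ∷ s) ++ ns ++ false ∷ t) ++ o
      ≡⟨ ++-assoc (ns ++ false ∷ s) (ns ++ false ∷ t) o ⟩
    (ns ++ false ∷ s) ++ (ns ++ false ∷ t) ++ o
      ≡⟨ cong ((ns ++ false ∷ s) ++_) (++-assoc ns (false ∷ t) o) ⟩
    (ns ++ false ∷ s) ++ ns ++ false ∷ t ++ o
      ≡⟨ ++-assoc ns (false ∷ s) _ ⟩
    ns ++ false ∷ s ++ ns ++ false ∷ t ++ o
      ≡⟨ cong (λ xs → ns ++ false ∷ s ++ xs) (++-assoc ns (false ∷ []) (t ++ o)) ⟨
    ns ++ false ∷ s ++ (ns ++ false ∷ []) ++ t ++ o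
      ≡⟨ cong (λ xs → ns ++ false ∷ xs) (++-assoc s (ns ++ false ∷ []) (t ++ o)) ⟨
    ns ++ false ∷ (s ++ ns ++ false ∷ []) ++ t ++ o
      ≡⟨ ++-assoc ns (false ∷ s ++ ns ++ false ∷ []) (t ++ o) ⟨
    (ns ++ false ∷ s ++ ns ++ false ∷ []) ++ t ++ o ∎)
  where
  open ≡-Reasoning
  ns s t : List Bool
  ns = replicate (g + h) true
  s  = concat (rows (source G h))
  t  = concat (rows (target {n = g + h} H w))

-- The list of instances and its encoding.

masks-length : ∀ j r → VAll.All (λ w → length w ≡ j + length r) (masks j r)
masks-length zero    r = refl VAll.∷ VAll.[]
masks-length (suc j) r =
  VAll.++⁺ (VAll.map (λ eq → trans eq (+-suc j (length r))) (masks-length j (true ∷ r)))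
    (VAll.++⁺ (VAll.map (λ eq → trans eq (+-suc j (length r))) (masks-length j (false ∷ r))) VAll.[])

-- `masks` prepends one digit after another, so choosing the digits of `w` in order produces `w`
-- reversed.
masks-complete : ∀ w r → w ʳ++ r ∈ masks (length w) r
masks-complete []          r = here refl
masks-complete (true  ∷ w) r = ∈-++⁺ˡ (masks-complete w (true ∷ r))
masks-complete (false ∷ w) r =
  ∈-++⁺ʳ (masks (length w) (true ∷ r)) (∈-++⁺ˡ (masks-complete w (false ∷ r)))

∈-masks : ∀ w → w ∈ masks (length w) []
∈-masks w = subst₂ (λ xs j → xs ∈ masks j []) (reverse-involutive w) (length-reverse w)
                   (masks-complete (List.reverse w) [])

instances : Graph g → Graph h → Vec (Instance (g + h)) (2 ^ (g + h))
instances {g} {h} G H = Vec.map (λ w → source G h , target H w) (masks (g + h) [])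

encode-instances : ∀ (G : Graph g) (H : Graph h) →
  encodeInstances (toList (instances G H)) ≡
  Vec.foldr′ (instanceBits (prefix (g + h) (sourceBits g h (rows G))) (rows H))
    (false ∷ []) (masks (g + h) [])
encode-instances {g} {h} G H = go (masks (g + h) []) (masks-length (g + h) [])
  where
  go : ∀ {l} (ws : Vec (List Bool) l) → VAll.All (λ w → length w ≡ g + h + 0) ws →
    encodeInstances (toList (Vec.map (λ w → source G h , target H w) ws)) ≡
    Vec.foldr′ (instanceBits (prefix (g + h) (sourceBits g h (rows G))) (rows H))
      (false ∷ []) ws
  go []       VAll.[]         = refl
  go (w ∷ ws) (|w| VAll.∷ eq) =
    trans (cong (λ xs → true ∷ encodePair (source G h) (target {n = g + h} H w) ++ xs) (go ws eq))
          (encode-instanceBits G H w _ (trans |w| (+-identityʳ (g + h))))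

-- Homomorphisms and embeddings

-- Words of length `n` with exactly `h` bars: each of the `h` blocks is closed by a bar and so has a
-- place for a further star.
data Mask : ℕ → ℕ → List Bool → Set where
  nil  : Mask 0 0 []
  bar  : ∀ {w} → Mask n h w → Mask (suc n) (suc h) (true ∷ w)
  star : ∀ {w} → Mask n h w → Mask (suc n) h (false ∷ w)

length-Mask : ∀ {w} → Mask n h w → length w ≡ n
length-Mask nil      = refl
length-Mask (bar μ)  = cong suc (length-Mask μ)
length-Mask (star μ) = cong suc (length-Mask μ)

bars : ∀ h → Mask h h (replicate h true)
bars zero    = nil
bars (suc h) = bar (bars h)

-- The new star goes directly before the bar that closes block `i`. No other star passes a bar, so
-- the old ones keep their blocks while their positions shift by `punchIn q`.
insert : ∀ {w} → Mask n h w → (i : Fin h) →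
  ∃[ w′ ] Σ[ q ∈ Fin (suc n) ] Mask (suc n) h w′ × block h w′ q ≡ just i ×
                 (∀ u → block h w′ (punchIn q u) ≡ block h w u)
insert {w = w} μ@(bar _) zero = false ∷ w , zero , star μ , refl , λ u → refl
insert (bar μ) (suc i) with insert μ i
... | w′ , q , μ′ , q↦i , old =
  true ∷ w′ , suc q , bar μ′ , cong (Maybe.map suc) q↦i ,
  λ { zero → refl ; (suc u) → cong (Maybe.map suc) (old u) }
insert {h = suc h} (star μ) i with insert μ i
... | w′ , q , μ′ , q↦i , old =
  false ∷ w′ , suc q , star μ′ , q↦i , λ { zero → refl ; (suc u) → old u }

-- Starting from `h` bars, which receive the padding vertices, one star is inserted for each vertex
-- of `G`.
place : (f : Fin g → Fin h) →
  ∃[ w ] Mask (g + h) h w × Σ[ p ∈ (Fin (g + h) → Fin (g + h)) ]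
    Injective _≡_ _≡_ p × (∀ u → block h w (p (u ↑ˡ h)) ≡ just (f u))
place {zero}  {h} f = replicate h true , bars h , (λ u → u) , (λ eq → eq) , λ ()
place {suc g} {h} f with place (f ∘ suc)
... | w , μ , p , p-inj , p↦f with insert μ (f zero)
... | w′ , q , μ′ , q↦f , old = w′ , μ′ , p′ , p′-inj , p′↦f
  where
  p′ : Fin (suc g + h) → Fin (suc g + h)
  p′ zero    = q
  p′ (suc u) = punchIn q (p u)
  p′-inj : Injective _≡_ _≡_ p′
  p′-inj {zero}  {zero}  eq = refl
  p′-inj {zero}  {suc v} eq = ⊥-elim (Fin.punchInᵢ≢i q (p v) (sym eq))
  p′-inj {suc u} {zero}  eq = ⊥-elim (Fin.punchInᵢ≢i q (p u) eq)
  p′-inj {suc u} {suc v} eq = cong suc (p-inj (Fin.punchIn-injective q (p u) (p v) eq))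
  p′↦f : ∀ u → block h w′ (p′ (u ↑ˡ h)) ≡ just (f u)
  p′↦f zero    = q↦f
  p′↦f (suc u) = trans (old (p (u ↑ˡ h))) (p↦f u)

homomorphism⇒embedding : (G : Graph g) (H : Graph h) → Homomorphism G H →
  ∃[ w ] length w ≡ g + h × pullback G (left {h = h} g) ⊆ target {n = g + h} H w
homomorphism⇒embedding {g} {h} G H (f , hom) with place f
... | w , μ , p , p-inj , p↦f = w , length-Mask μ , p , p-inj , edge
  where
  edge : IsHomomorphism (pullback G (left {h = h} g)) (target H w) p
  edge u v e with left g u in eqᵤ | left g v in eqᵥ
  -- Padding vertices are isolated, so both ends of an edge come from `G`.
  ... | just i | just j
    rewrite sym (left-just g u eqᵤ) | sym (left-just g v eqᵥ) | p↦f i | p↦f j = hom i j e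

embedding⇒homomorphism : (G : Graph g) (H : Graph (suc h)) (w : List Bool) →
  pullback G (left {h = suc h} g) ⊆ target {n = g + suc h} H w → Homomorphism G H
embedding⇒homomorphism {g} {h} G H w (p , _ , edge) =
  -- Only an isolated vertex of `G` can lie outside all blocks, and it may go anywhere; `zero`
  -- exists as `H` is not null.
  (λ u → Maybe.fromMaybe zero (block (suc h) w (p (u ↑ˡ suc h)))) ,
  λ u v e → link-edge H (block (suc h) w (p (u ↑ˡ suc h))) (block (suc h) w (p (v ↑ˡ suc h)))
    (edge (u ↑ˡ suc h) (v ↑ˡ suc h)
      (subst₂ (λ i j → T (link G i j)) (sym (left-↑ˡ (suc h) u)) (sym (left-↑ˡ (suc h) v)) e))

-- A blow-up of the null graph has no edge, whereas the centre of the star is adjacent to vertex 1.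
starGraph⊈target : ∀ (H : Graph 0) (w : List Bool) → ¬ starGraph (2 + n) ⊆ target {n = m} H w
starGraph⊈target H w (p , _ , edge) with link-nowhere (block 0 w (p 0F)) (edge 0F 1F _)
  where
  link-nowhere : ∀ i {j} → ¬ T (link H i j)
  link-nowhere nothing ()
... | ()

-- If both graphs are null, both sides hold; if only `H` is null, then `g` is at least 2 and both
-- sides fail. Otherwise the two constructions above apply.
homomorphism⇔instance : (G : Graph g) (H : Graph h) → ¬ (g ≡ 1 × h ≡ 0) →
  Homomorphism G H ⇔ Any YesInstance (instances G H)
homomorphism⇔instance {zero} {zero} G H _ =
  mk⇔ (λ _ → here yes) (λ _ → (λ ()) , λ ())
  where
  yes : source G 0 ⊆ target {n = 0} H []
  yes = (λ ()) , (λ {u} → ⊥-elim (Fin.¬Fin0 u)) , λ ()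
homomorphism⇔instance {suc zero} {zero} G H ¬1 = ⊥-elim (¬1 (refl , refl))
homomorphism⇔instance {suc (suc g)} {zero} G H _ =
  mk⇔ (λ (f , _) → ⊥-elim (Fin.¬Fin0 (f zero)))
      (λ yes → let w , emb = Any.satisfied (Any.map⁻ yes) in ⊥-elim (starGraph⊈target H w emb))
homomorphism⇔instance {g} {suc h} G H _ = mk⇔ to
  (λ yes → let w , emb = Any.satisfied (Any.map⁻ yes) in embedding⇒homomorphism G H w emb)
  where
  to : Homomorphism G H → Any YesInstance (instances G H)
  to hom with homomorphism⇒embedding G H hom
  ... | w , |w| , emb = Any.map⁺ (Any.map (λ { refl → emb })
    (subst (λ n → w ∈ masks n []) |w| (∈-masks w)))

-- The running time

-- The exact length of `prefix` with an n by n matrix, the longest string that a loop runs through.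
bound : ℕ → ℕ
bound n = 3 + (n + n) + n * n

^-distrib-* : ∀ a b e → (a * b) ^ e ≡ a ^ e * b ^ e
^-distrib-* a b zero    = refl
^-distrib-* a b (suc e) =
  trans (cong (a * b *_) (^-distrib-* a b e)) ([m*n]*[o*p]≡[m*o]*[n*p] a b (a ^ e) (b ^ e))

-- For positive `n` the base is at most three times `n`; the constant term takes care of `n = 0`.
2+n^e≤ : ∀ n e → (2 + n) ^ e ≤ 3 ^ e * n ^ e + 3 ^ e
2+n^e≤ zero    e = ≤-trans (^-monoˡ-≤ e (s≤s (s≤s z≤n))) (m≤n+m (3 ^ e) _)
2+n^e≤ (suc n) e = begin
  (3 + n) ^ e                 ≤⟨ ^-monoˡ-≤ e 3+n≤3*suc-n ⟩
  (3 * suc n) ^ e             ≡⟨ ^-distrib-* 3 (suc n) e ⟩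
  3 ^ e * suc n ^ e           ≤⟨ m≤m+n _ (3 ^ e) ⟩
  3 ^ e * suc n ^ e + 3 ^ e   ∎
  where
  open ≤-Reasoning
  3+n≤3*suc-n : 3 + n ≤ 3 * suc n
  3+n≤3*suc-n = subst (3 + n ≤_) (sym (*-suc 3 n)) (+-monoʳ-≤ 3 (m≤n*m n 3))

suc-bound≤ : ∀ n → suc (bound n) ≤ (2 + n) ^ 2
suc-bound≤ n = subst (suc (bound n) ≤_) (sym (expanded n)) (m≤m+n (suc (bound n)) (n + n))
  where
  expanded : ∀ n → (2 + n) * ((2 + n) * 1) ≡ 4 + (n + n) + n * n + (n + n)
  expanded = solve-∀

-- Unfolded, the coefficient is a huge number.
abstract
  polynomial-cost : (P : Program k) → ∃[ c ] ∃[ d ] ∀ n → cost (bound n) P ≤ c * n ^ d + c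
  polynomial-cost P = s * 3 ^ e , e , λ n → begin
    cost (bound n) P                      ≤⟨ cost-polynomial (bound n) P ⟩
    s * suc (bound n) ^ degree P          ≤⟨ *-monoʳ-≤ s (^-monoˡ-≤ (degree P) (suc-bound≤ n)) ⟩
    s * ((2 + n) ^ 2) ^ degree P          ≡⟨ cong (s *_) (^-*-assoc (2 + n) 2 (degree P)) ⟩
    s * (2 + n) ^ e                       ≤⟨ *-monoʳ-≤ s (2+n^e≤ n e) ⟩
    s * (3 ^ e * n ^ e + 3 ^ e)           ≡⟨ *-distribˡ-+ s (3 ^ e * n ^ e) (3 ^ e) ⟩
    s * (3 ^ e * n ^ e) + s * 3 ^ e       ≡⟨ cong (_+ s * 3 ^ e) (*-assoc s (3 ^ e) (n ^ e)) ⟨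
    s * 3 ^ e * n ^ e + s * 3 ^ e         ∎
    where
    open ≤-Reasoning
    s e : ℕ
    s = size P
    e = 2 * degree P

-- The reduction program.

reductionᵖ : Program 12
reductionᵖ = setupᵖ ⨾ while 6F empty instanceᵖ

-- Its cost bounds one execution of each of the two parts.
partsᵖ : Program 12
partsᵖ = if 0F empty (setupᵖ ⨾ skip) instanceᵖ

-- The `1` is the cost of `skip` in `partsᵖ`; it pays for the test that ends the counter loop.
time-parts : ∀ {s t a b N} → s ≤ a → t ≤ suc ((N + 0) * suc b) → 1 ≤ N →
             s + t ≤ suc (a + 1 + b) * N
time-parts {s} {t} {a} {b} {N} s≤a t≤ 1≤N = begin
  s + t                         ≤⟨ +-mono-≤ s≤a t≤ ⟩
  a + suc ((N + 0) * suc b)     ≡⟨ +-suc a _ ⟩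
  suc a + (N + 0) * suc b       ≡⟨ cong (λ l → suc a + l * suc b) (+-identityʳ N) ⟩
  suc a + N * suc b             ≡⟨ cong (suc a +_) (*-comm N (suc b)) ⟩
  suc a + suc b * N             ≤⟨ +-monoˡ-≤ (suc b * N) (m≤m*n (suc a) N {{>-nonZero 1≤N}}) ⟩
  suc a * N + suc b * N         ≡⟨ *-distribʳ-+ N (suc a) (suc b) ⟨
  (suc a + suc b) * N           ≡⟨ cong (λ l → suc l * N) (trans (+-suc a b) (cong (_+ b) (+-comm 1 a))) ⟩
  suc (a + 1 + b) * N           ∎
  where open ≤-Reasoning

reduction-instances : ∀ (G : Graph g) (H : Graph h) →
  ∃[ t ] t ≤ cost (bound (g + h)) partsᵖ * 2 ^ (g + h) ×
         reductionᵖ on encodePair G H outputs encodeInstances (toList (instances G H)) in-time t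
reduction-instances {g} {h} G H =
  _ , time-parts (Run.time≤ setup) (Loop.time≤ main) (m^n>0 2 (g + h)) ,
  _ , seq (Run.halts setup) (Loop.halts main) , sym (encode-instances G H)
  where
  N M : ℕ
  N = g + h
  M = bound N

  n*n≤m : N * N ≤ M
  n*n≤m = m≤n+m (N * N) (3 + (N + N))

  n≤m : N ≤ M
  n≤m = ≤-trans (m≤n+m N (3 + N)) (≤-trans (≤-reflexive (+-assoc 3 N N)) (m≤m+n _ (N * N)))

  e : List Bool
  e = prefix N (sourceBits g h (rows G))

  |rowsG|≤m : length (concat (rows G)) ≤ M
  |rowsG|≤m = ≤-trans (≤-reflexive (length-concat-tabulate g (adj G)))
    (≤-trans (*-mono-≤ (m≤m+n g h) (m≤m+n g h)) n*n≤m)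

  |rowsH|≤m : length (concat (rows H)) ≤ M
  |rowsH|≤m = ≤-trans (≤-reflexive (length-concat-tabulate h (adj H)))
    (≤-trans (*-mono-≤ (m≤n+m h g) (m≤n+m h g)) n*n≤m)

  |e| : length e ≡ M
  |e| = cong suc (begin
    length (ns ++ false ∷ sourceBits g h (rows G) ++ ns ++ false ∷ [])
      ≡⟨ length-++ ns ⟩
    length ns + suc (length (sourceBits g h (rows G) ++ ns ++ false ∷ []))
      ≡⟨ cong (λ l → length ns + suc l) (length-++ (sourceBits g h (rows G))) ⟩
    length ns + suc (length (sourceBits g h (rows G)) + length (ns ++ false ∷ []))
      ≡⟨ cong (λ l → length ns + suc (length (sourceBits g h (rows G)) + l)) (length-++ ns) ⟩
    length ns + suc (length (sourceBits g h (rows G)) + (length ns + 1))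
      ≡⟨ cong₂ (λ a b → a + suc (b + (a + 1))) (length-replicate N)
           (trans (cong length (sourceBits-source G h)) (length-concat-tabulate N _)) ⟩
    N + suc (N * N + (N + 1))
      ≡⟨ rearrange N ⟩
    2 + (N + N) + N * N ∎)
    where
    open ≡-Reasoning
    ns : List Bool
    ns = replicate N true
    rearrange : ∀ n → n + (1 + (n * n + (n + 1))) ≡ 2 + (n + n) + n * n
    rearrange = solve-∀

  encode-input : encodePair G H ≡ input g (rows G) h (concat (rows H))
  encode-input = trans (++-assoc (replicate g true) _ (encodeGraph H))
    (cong (λ xs → replicate g true ++ false ∷ xs) (concat-foldr (rows G)))
    where
    concat-foldr : ∀ rs → concat rs ++ encodeGraph H ≡ List.foldr _++_ (encodeGraph H) rs
    concat-foldr []       = refl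
    concat-foldr (r ∷ rs) = trans (++-assoc r (concat rs) _) (cong (r ++_) (concat-foldr rs))

  no-rows : h ≡ 0 → concat (rows H) ≡ []
  no-rows refl = refl

  initial : List Bool → Store 12
  initial xs = xs ∷ Vec.replicate 11 []

  setup : Run M setupᵖ (initial (encodePair G H))
            (store e (replicate h true) (rows H) [] (replicate N false ʳ++ []) (false ∷ []))
  setup = subst₂ (λ xs w → Run M setupᵖ (initial xs)
                             (store e (replicate h true) (rows H) [] w (false ∷ [])))
    (sym encode-input)
    (sym (trans (replicate-ʳ++ N 0 false) (cong (λ a → replicate a false) (+-identityʳ N))))
    (setup-store (rows-All G) (sym (length-tabulate _)) n≤m |rowsG|≤m
      {rowsH = rows H} no-rows |rowsH|≤m (≤-reflexive |e|))

  main : Loop M 6F empty instanceᵖ (2 ^ N + 0)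
    (store e (replicate h true) (rows H) [] (replicate N false ʳ++ []) (false ∷ []))
    (store e (replicate h true) (rows H) (true ∷ []) (replicate N false ʳ++ [])
      (Vec.foldr′ (instanceBits e (rows H)) (false ∷ []) (masks N [])))
  main = enumerate
    (subst (λ a → All ((a ≡_) ∘ length) (rows H)) (sym (length-replicate h)) (rows-All H))
    (≤-trans (≤-reflexive (length-replicate h)) (≤-trans (m≤n+m h g) n≤m))
    |rowsH|≤m (≤-reflexive |e|) n≤m
    (λ w |w| → ≤-trans (≤-reflexive (trans (cong length (expandRows-target H w |w|))
                                           (length-concat-tabulate N _))) n*n≤m)
    -- With no digit fixed in advance the final overflow is `true ∷ []`, at which the loop stops.
    N [] (+-identityʳ N) (exit refl)

theorem6 : ∃[ k ] Σ[ P ∈ Program (suc k) ] ∃[ c ] ∃[ d ]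
    ∀ {g h : ℕ} (G : Graph g) (H : Graph h) →
    ¬ (g ≡ 1 × h ≡ 0) →
    let n = g + h in
    Σ[ instances ∈ Vec (Instance n) (2 ^ n) ]
    (∃[ t ] t ≤ (c * n ^ d + c) * 2 ^ n ×
    P on encodePair G H outputs encodeInstances (toList instances) in-time t) ×
    (Homomorphism G H ⇔ Any YesInstance instances)
theorem6 =
  let c , d , cost≤ = polynomial-cost partsᵖ in
  11 , reductionᵖ , c , d , λ {g} {h} G H ¬null-target →
  let t , t≤ , outputs = reduction-instances G H in
  instances G H ,
  (t , ≤-trans t≤ (*-monoˡ-≤ (2 ^ (g + h)) (cost≤ (g + h))) , outputs) ,
  homomorphism⇔instance G H ¬null-target
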